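{- Let $p$ be an odd prime, $k\ge1$, $s\ge2$, $0\le l<p^k$ with $l=\alpha p+\beta$ ($0\le\alpha<p^{k-1}$, $0\le\beta\le p-1$), and let $0\le t'\le p-1$, $0\le\beta'\le p-1$. Define $$m_{2s-1}=p^k(p-1)-\big((p-1)(\alpha+p^{k-1}t')+\beta\big),\quad m_{2s}=p^kt',\quad m_{2s+1}=p^k(p-1)-\big((p-1)l+\beta'\big),$$ and $n_j=p^k(p-1)-m_j$ for $j\in\{2s-1,2s,2s+1\}$. Say "there is a descent at $2s-1$" if $m_{2s-1}>m_{2s}$ and $n_{2s-1}<n_{2s}$, and "there is a descent at $2s$" if $m_{2s}>m_{2s+1}$ and $n_{2s}<n_{2s+1}$. Then, with $j^k_t=t\sum_{\iota=0}^{k-1}p^\iota$: (1) if $l<\frac{p^k-1}{2}$, there is a descent at $2s-1$ if and only if $0\le t'\le\frac{p-1}{2}$ (for every $\beta'$); (2) if $l\ge\frac{p^k-1}{2}$, there is a descent at $2s-1$ if and only if $0\le t'<\frac{p-1}{2}$ (for every $\beta'$); (3) if $1\le t\le p-1$ and $j^k_{t-1}<l<j^k_t$, there is a descent at $2s$ if and only if $p-t\le t'\le p-1$ (for every $\beta'$); (4) if $0\le t\le p-1$ and $l=j^k_t$, then there is a descent at $2s$ if and only if $p-t\le t'\le p-1$ when $\beta'\le t$, and if and only if $p-t-1\le t'\le p-1$ when $\beta'>t$.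
   Context: Interpretation (not needed for the arithmetic claim): in the $p$-Bratteli diagram whose vertices are hook partitions, $m_{2s-1},m_{2s},m_{2s+1}$ are the numbers of horizontal nodes of the last three blocks (each of total size $p^k(p-1)$, $n_j$ being the number of vertical nodes) added along a path which passes, in column $k$, through a vertex indexed $l+p^kt'$ on floor $2(k+s)-1$, then the vertex indexed $l$ on floor $2(k+s)$, and ends at the vertex indexed $pl+\beta'$ on floor $2(k+s)+1$; a descent at position $j$ means block $j$ exceeds block $j+1$ in the sense $m_j>m_{j+1}$, $n_j<n_{j+1}$. -}

module Defs where

open import Data.Nat using (ℕ; suc; _∸_; _^_)
open import Data.Integer using (ℤ; +_; _+_; _-_; _*_; _<_; _>_; 1ℤ)
open import Data.List using (List; []; _∷_; map; sum; upTo)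
open import Data.List.Membership.Propositional using (_∈_)
open import Data.Product using (_×_)
open import Relation.Binary.PropositionalEquality using (_≡_)
import Data.Nat as ℕ

-- j^k_t = t · Σ_{ι=0}^{k-1} p^ι
jIndex : (p k t : ℕ) → ℕ
jIndex p k t = t ℕ.* sum (map (p ^_) (upTo k))

blockSize : (p k : ℕ) → ℤ
blockSize p k = + (p ^ k) * (+ p - 1ℤ)

-- The numbers m_j (horizontal) and n_j (vertical) are families of integers
-- indexed by j, constrained only at j = 2s-1, 2s, 2s+1.  They are integers so
-- that the subtractions below are genuine; k ∸ 1 and 2 s ∸ 1 are used only
-- for k ≥ 1 and s ≥ 2.
record LastThreeBlocks (p k s l α β t′ β′ : ℕ) (m n : ℕ → ℤ) : Set where
  field
    m[2s-1] : m (2 ℕ.* s ∸ 1)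
              ≡ blockSize p k - ((+ p - 1ℤ) * (+ α + + (p ^ (k ∸ 1)) * + t′) + + β)
    m[2s]   : m (2 ℕ.* s) ≡ + (p ^ k) * + t′
    m[2s+1] : m (2 ℕ.* s ℕ.+ 1) ≡ blockSize p k - ((+ p - 1ℤ) * + l + + β′)
    n[_]    : ∀ j → j ∈ (2 ℕ.* s ∸ 1) ∷ (2 ℕ.* s) ∷ (2 ℕ.* s ℕ.+ 1) ∷ [] →
              n j ≡ blockSize p k - m j

DescentAt : (m n : ℕ → ℤ) → ℕ → Set
DescentAt m n j = m j > m (suc j) × n j < n (suc j)

{-# OPTIONS --safe #-}
-- Write q = p - 1, N = p ^ k and P = p ^ (k - 1).  A descent at 2s - 1 says
--   (q α + β) + P (p + q) t′ < N q,
-- and a descent at 2s says N q < N t′ + (q l + β′).  Both are linear in t′, so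
-- each is decided by a threshold, found by locating the constant term between
-- consecutive multiples of the slope.  For 2s - 1 the constant q α + β is
-- l - ⌊l / p⌋, which is monotone in l; with q = 2 h it is compared with P h,
-- essentially its value at l = (N - 1) / 2.  For 2s one uses N = 1 + q S with
-- S = Σ p ^ ι, so that q j^k_t = t (N - 1).
module Submission where

open import Data.Nat using (ℕ; zero; suc; _+_; _*_; _∸_; _^_; _/_; _%_; _≤_; _<_; _≥_; _>_; z≤n; s≤s; s≤s⁻¹)
open import Data.Nat.Properties
open import Data.Nat.DivMod using (m≡m%n+[m/n]*n; m%n<n; m*n/n≡m)
open import Data.Nat.Divisibility using (_∤_; m%n≡0⇒n∣m)
open import Data.Nat.ListAction using (sum)
open import Data.Nat.ListAction.Properties using (sum-++)
open import Data.Nat.Primality using (Prime; ¬prime[1])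
open import Data.Nat.Tactic.RingSolver using (solve-∀)
open import Data.Integer using (ℤ; +_; +<+)
open import Data.List using (_∷_; []; map; upTo)
open import Data.List.Properties using (upTo-∷ʳ; map-++)
open import Data.List.Relation.Unary.Any using (here; there)
open import Data.Product using (_×_; _,_; ∃; proj₁; proj₂)
open import Data.Empty using (⊥-elim)
open import Function.Bundles using (_⇔_; mk⇔)
open import Function.Construct.Composition using (_⇔-∘_)
open import Relation.Binary.Definitions using (tri<; tri≈; tri>)
open import Relation.Binary.PropositionalEquality using (_≡_; refl; sym; trans; cong; cong₂; subst; subst₂; module ≡-Reasoning)
open import Relation.Nullary.Negation using (contradiction)
import Data.Integer as ℤ
import Data.Integer.Properties as ℤ
import Data.Integer.Tactic.RingSolver as ℤ-Solver
open import Defs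

-- Parity and the geometric sum

odd⇒1+2h : ∀ n → 2 ∤ n → ∃ λ h → n ≡ suc (h * 2)
odd⇒1+2h n 2∤n with n % 2 in eq | m≡m%n+[m/n]*n n 2 | m%n<n n 2
... | 0           | _   | _                = contradiction (m%n≡0⇒n∣m n 2 eq) 2∤n
... | 1           | n≡  | _                = n / 2 , n≡
... | suc (suc _) | _   | s≤s (s≤s ())

-- Induction on `k`: `p * p^k` is `p^k + q * p^k`, and the second term extends the sum at its right
-- end. `jIndex p k 1` stands for the geometric sum itself.
^≡1+pred*geometric : ∀ q k → suc q ^ k ≡ suc (q * jIndex (suc q) k 1)
^≡1+pred*geometric q zero    = cong suc (sym (*-zeroʳ q))
^≡1+pred*geometric q (suc k) = begin
  suc q * p^k                             ≡⟨⟩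
  p^k + q * p^k                           ≡⟨ cong (_+ q * p^k) (^≡1+pred*geometric q k) ⟩
  suc (q * jIndex (suc q) k 1) + q * p^k  ≡⟨ step q (S k) p^k ⟩
  suc (q * (1 * (S k + (p^k + 0))))       ≡⟨ cong (λ x → suc (q * (1 * x))) S-suc ⟨
  suc (q * jIndex (suc q) (suc k) 1)      ∎
  where
  open ≡-Reasoning
  p^k = suc q ^ k

  S : ℕ → ℕ
  S k = sum (map (suc q ^_) (upTo k))

  S-suc : S (suc k) ≡ S k + (p^k + 0)
  S-suc = trans (cong sum
                  (trans (cong (map (suc q ^_)) (sym (upTo-∷ʳ k)))
                         (map-++ (suc q ^_) (upTo k) (k ∷ []))))
                (sum-++ (map (suc q ^_) (upTo k)) (p^k ∷ []))

  step : ∀ q s x → suc (q * (1 * s)) + q * x ≡ suc (q * (1 * (s + (x + 0))))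
  step = solve-∀

jIndex≡*jIndex-1 : ∀ p k t → jIndex p k t ≡ t * jIndex p k 1
jIndex≡*jIndex-1 p k t = cong (t *_) (sym (*-identityˡ _))

-- Linear inequalities in t as thresholds

-- The hypotheses place `B` above the value at `f - 1` and at most at the value at `f`, written
-- without subtraction.
linear<⇔ : ∀ {B W c f} t → B ≤ c + W * f → c + W * f < B + W →
           c + W * t < B ⇔ t < f
linear<⇔ {B} {W} {c} {f} t B≤ <B+W = mk⇔
  (λ <B → ≰⇒> λ f≤t → <⇒≱ <B (≤-trans B≤ (+-monoʳ-≤ c (*-monoʳ-≤ W f≤t))))
  (λ t<f → +-cancelʳ-< W _ _ (begin-strict
    c + W * t + W   ≡⟨ step c W t ⟩
    c + W * suc t   ≤⟨ +-monoʳ-≤ c (*-monoʳ-≤ W t<f) ⟩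
    c + W * f       <⟨ <B+W ⟩
    B + W           ∎))
  where
  open ≤-Reasoning
  step : ∀ c W t → c + W * t + W ≡ c + W * suc t
  step = solve-∀

-- Here `e` is `c / N` rounded up, so the inequality amounts to `q < t + e`, and `f` is the
-- complement of `e` in `suc q`.
<linear⇔ : ∀ {N q c e f} t → e + f ≡ suc q → c ≤ N * e → N * e < c + N →
           N * q < N * t + c ⇔ f ≤ t
<linear⇔ {N} {q} {c} {e} {f} t e+f≡ c≤ <c+N = mk⇔
  (λ <l → ≮⇒≥ λ t<f → <⇒≱ <l (begin
    N * t + c      ≤⟨ +-monoʳ-≤ (N * t) c≤ ⟩
    N * t + N * e  ≡⟨ *-distribˡ-+ N t e ⟨
    N * (t + e)    ≤⟨ *-monoʳ-≤ N (s≤s⁻¹ (begin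
      suc t + e      ≤⟨ +-monoˡ-≤ e t<f ⟩
      f + e          ≡⟨ +-comm f e ⟩
      e + f          ≡⟨ e+f≡ ⟩
      suc q          ∎)) ⟩
    N * q          ∎))
  (λ f≤t → +-cancelʳ-< N _ _ (begin-strict
    N * q + N       ≡⟨ step₁ N q ⟩
    N * suc q       ≡⟨ cong (N *_) e+f≡ ⟨
    N * (e + f)     ≡⟨ step₂ N e f ⟩
    N * f + N * e   <⟨ +-mono-≤-< (*-monoʳ-≤ N f≤t) <c+N ⟩
    N * t + (c + N) ≡⟨ +-assoc (N * t) c N ⟨
    N * t + c + N   ∎))
  where
  open ≤-Reasoning
  step₁ : ∀ N q → N * q + N ≡ N * suc q
  step₁ = solve-∀
  step₂ : ∀ N e f → N * (e + f) ≡ N * f + N * e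
  step₂ = solve-∀

-- The map x ↦ x - ⌊x / (1 + q)⌋ is monotone.
quotient-removal-mono : ∀ {q α β α′ β′} → β ≤ q → β′ ≤ q →
  α * suc q + β ≤ α′ * suc q + β′ → q * α + β ≤ q * α′ + β′
quotient-removal-mono {q} {α} {β} {α′} {β′} β≤q β′≤q le with <-cmp α α′
... | tri< α<α′ _ _ = begin
  q * α + β    ≤⟨ +-monoʳ-≤ (q * α) β≤q ⟩
  q * α + q    ≡⟨ +-comm (q * α) q ⟩
  q + q * α    ≡⟨ *-suc q α ⟨
  q * suc α    ≤⟨ *-monoʳ-≤ q α<α′ ⟩
  q * α′       ≤⟨ m≤m+n _ _ ⟩
  q * α′ + β′  ∎
  where open ≤-Reasoning
... | tri≈ _ refl _ = +-monoʳ-≤ (q * α) (+-cancelˡ-≤ (α * suc q) _ _ le)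
... | tri> _ _ α′<α = contradiction le (<⇒≱ (begin-strict
  α′ * suc q + β′     <⟨ +-monoʳ-< (α′ * suc q) (s≤s β′≤q) ⟩
  α′ * suc q + suc q  ≡⟨ +-comm (α′ * suc q) (suc q) ⟩
  suc α′ * suc q      ≤⟨ *-monoˡ-≤ (suc q) α′<α ⟩
  α * suc q           ≤⟨ m≤m+n _ _ ⟩
  α * suc q + β       ∎))
  where open ≤-Reasoning

-- The fibres of x ↦ x - ⌊x / (1 + q)⌋ with two points are {j (1 + q) - 1, j (1 + q)},
-- so it is strictly monotone below an x that is not a multiple of 1 + q.
quotient-removal-mono-< : ∀ {q α β α′ β′} → β ≤ q → β′ ≤ q → β′ > 0 →
  α * suc q + β < α′ * suc q + β′ → q * α + β < q * α′ + β′
quotient-removal-mono-< {q} {α} {β} {α′} {suc γ} β≤q γ<q _ lt =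
  -- Lowering the positive remainder `suc γ` to `γ` takes one off both right-hand sides, which turns
  -- the strict claim into the weak one.
  subst (q * α + β <_) (sym (+-suc (q * α′) γ))
    (s≤s (quotient-removal-mono {q} {α} {α′ = α′} β≤q (<⇒≤ γ<q)
      (s≤s⁻¹ (subst (α * suc q + β <_) (+-suc (α′ * suc q) γ) lt))))

-- Descents as inequalities of natural numbers

+<-⇔ : ∀ a b B → + b ℤ.< + B ℤ.- + a ⇔ a + b < B
+<-⇔ a b B = mk⇔
  (λ lt → ℤ.drop‿+<+ (subst (+ a ℤ.+ + b ℤ.<_) (step₁ (+ a) (+ B)) (ℤ.+-monoʳ-< (+ a) lt)))
  (λ lt → subst₂ ℤ._<_ (step₂ (+ a) (+ b)) (step₃ (+ a) (+ B)) (ℤ.+-monoʳ-< (ℤ.- + a) (+<+ lt)))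
  where
  step₁ : ∀ x y → x ℤ.+ (y ℤ.- x) ≡ y
  step₁ = ℤ-Solver.solve-∀
  step₂ : ∀ x y → ℤ.- x ℤ.+ (x ℤ.+ y) ≡ y
  step₂ = ℤ-Solver.solve-∀
  step₃ : ∀ x y → ℤ.- x ℤ.+ y ≡ y ℤ.- x
  step₃ = ℤ-Solver.solve-∀

-<+⇔ : ∀ a b B → + B ℤ.- + a ℤ.< + b ⇔ B < b + a
-<+⇔ a b B = mk⇔
  (λ lt → ℤ.drop‿+<+ (subst (ℤ._< + b ℤ.+ + a) (step₁ (+ a) (+ B)) (ℤ.+-monoˡ-< (+ a) lt)))
  (λ lt → subst (+ B ℤ.- + a ℤ.<_) (step₂ (+ a) (+ b)) (ℤ.+-monoˡ-< (ℤ.- + a) (+<+ lt)))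
  where
  step₁ : ∀ x y → y ℤ.- x ℤ.+ x ≡ y
  step₁ = ℤ-Solver.solve-∀
  step₂ : ∀ x y → y ℤ.+ x ℤ.- x ≡ y
  step₂ = ℤ-Solver.solve-∀

-- Subtraction from the common `B` reverses order, so the inequality of the `n` follows from that of
-- the `m`.
descentAt⇔ : ∀ {m n j B} → n j ≡ B ℤ.- m j → n (suc j) ≡ B ℤ.- m (suc j) →
             DescentAt m n j ⇔ m (suc j) ℤ.< m j
descentAt⇔ {B = B} nj nsj = mk⇔ proj₁
  (λ lt → lt , subst₂ ℤ._<_ (sym nj) (sym nsj) (ℤ.+-monoʳ-< B (ℤ.neg-mono-< lt)))

module _ {q k s l α β t′ β′ m n}
         (blocks : LastThreeBlocks (suc q) k s l α β t′ β′ m n) where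
  open LastThreeBlocks blocks

  private
    N = suc q ^ k
    P = suc q ^ (k ∸ 1)

    blockSize≡ : blockSize (suc q) k ≡ + (N * q)
    blockSize≡ = sym (ℤ.pos-* N q)

    m[2s]≡ : m (2 * s) ≡ + (N * t′)
    m[2s]≡ = trans m[2s] (sym (ℤ.pos-* N t′))

    m[2s-1]≡ : m (2 * s ∸ 1) ≡ + (N * q) ℤ.- + (q * (α + P * t′) + β)
    m[2s-1]≡ = trans m[2s-1] (cong₂ ℤ._-_ blockSize≡
      (cong (ℤ._+ + β) (trans (cong (λ x → + q ℤ.* (+ α ℤ.+ x)) (sym (ℤ.pos-* P t′)))
                              (sym (ℤ.pos-* q (α + P * t′))))))

    m[2s+1]≡ : m (2 * s + 1) ≡ + (N * q) ℤ.- + (q * l + β′)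
    m[2s+1]≡ = trans m[2s+1] (cong₂ ℤ._-_ blockSize≡ (cong (ℤ._+ + β′) (sym (ℤ.pos-* q l))))

  descentAt[2s-1]⇔ : s ≥ 2 →
    DescentAt m n (2 * s ∸ 1) ⇔ q * (α + P * t′) + β + N * t′ < N * q
  -- Exposing `s` as a successor makes `suc (2 * s ∸ 1)` compute to `2 * s`.
  descentAt[2s-1]⇔ (s≤s _) =
    +<-⇔ (q * (α + P * t′) + β) (N * t′) (N * q) ⇔-∘ (
      mk⇔ (subst₂ ℤ._<_ m[2s]≡ m[2s-1]≡) (subst₂ ℤ._<_ (sym m[2s]≡) (sym m[2s-1]≡)) ⇔-∘
      descentAt⇔ {m} {n} {B = blockSize (suc q) k} (n[_] _ (here refl)) (n[_] _ (there (here refl))))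

  descentAt[2s]⇔ : DescentAt m n (2 * s) ⇔ N * q < N * t′ + (q * l + β′)
  descentAt[2s]⇔ =
    -<+⇔ (q * l + β′) (N * t′) (N * q) ⇔-∘ (
      mk⇔ (subst₂ ℤ._<_ m[suc2s]≡ m[2s]≡) (subst₂ ℤ._<_ (sym m[suc2s]≡) (sym m[2s]≡)) ⇔-∘
      descentAt⇔ {m} {n} {B = blockSize (suc q) k} (n[_] _ (there (here refl)))
        (n[_] _ (there (there (here (sym (+-comm (2 * s) 1)))))))
    where
    m[suc2s]≡ : m (suc (2 * s)) ≡ + (N * q) ℤ.- + (q * l + β′)
    m[suc2s]≡ = trans (cong m (sym (+-comm (2 * s) 1))) m[2s+1]≡

-- The threshold at 2s - 1, with p = 1 + 2h, P = p ^ (k - 1) and R = Σ_{ι < k - 1} p ^ ι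

module _ {h P R α β : ℕ} (t′ : ℕ) (P≡ : P ≡ suc (h * 2 * R)) (β≤q : β ≤ h * 2) where
  private
    q = h * 2
    p = suc q
    W = P * (p + q)
    c = q * α + β

    regroup : ∀ h P α β t → h * 2 * (α + P * t) + β + suc (h * 2) * P * t
                          ≡ h * 2 * α + β + P * (suc (h * 2) + h * 2) * t
    regroup = solve-∀

    -- Since `2 * p = 1 + (p + q)`, the block size is `h` times the slope `W` plus a remainder
    -- `P * h`; comparing `c` with this remainder decides whether `t′ = h` gives a descent.
    block-split : ∀ h P → suc (h * 2) * P * (h * 2) ≡ P * h + P * (suc (h * 2) + h * 2) * h
    block-split = solve-∀

    regroup⇔ : q * (α + P * t′) + β + p * P * t′ < p * P * q ⇔ c + W * t′ < P * h + W * h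
    regroup⇔ = mk⇔ (subst₂ _<_ (regroup h P α β t′) (block-split h P))
                   (subst₂ _<_ (sym (regroup h P α β t′)) (sym (block-split h P)))

    h≤q : h ≤ q
    h≤q = m≤m*n h 2

    -- By `half≡`, `h * R` and `h` are the quotient and remainder of `(N - 1) / 2` by `p`, so
    -- `P * h` is the value of `q * α + β` at that point.
    P*h≡ : P * h ≡ q * (h * R) + h
    P*h≡ = trans (cong (_* h) P≡) (step h R)
      where
      step : ∀ h R → suc (h * 2 * R) * h ≡ h * 2 * (h * R) + h
      step = solve-∀

    half≡ : (p * P ∸ 1) / 2 ≡ h * R * p + h
    half≡ = trans (cong (λ x → (p * x ∸ 1) / 2) P≡)
           (trans (cong (λ x → (x ∸ 1) / 2) (step h R)) (m*n/n≡m (h * R * p + h) 2))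
      where
      step : ∀ h R → suc (h * 2) * suc (h * 2 * R) ≡ suc ((h * R * suc (h * 2) + h) * 2)
      step = solve-∀

  -- The threshold is `suc h`: strict monotonicity, available because the remainder `h` is positive,
  -- gives `c < P * h` and admits `t′ = h`, while `P * h ≤ W` excludes `suc h`.
  <half⇒≤⇔ : h > 0 → α * p + β < (p * P ∸ 1) / 2 →
    q * (α + P * t′) + β + p * P * t′ < p * P * q ⇔ t′ ≤ h
  <half⇒≤⇔ h>0 l< =
    mk⇔ s≤s⁻¹ s≤s ⇔-∘ (linear<⇔ t′ lower upper ⇔-∘ regroup⇔)
    where
    open ≤-Reasoning
    c<P*h : c < P * h
    c<P*h = subst (c <_) (sym P*h≡)
      (quotient-removal-mono-< {q} {α} {α′ = h * R} β≤q h≤q h>0 (subst (α * p + β <_) half≡ l<))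

    lower : P * h + W * h ≤ c + W * suc h
    lower = begin
      P * h + W * h    ≤⟨ +-monoˡ-≤ (W * h) (*-monoʳ-≤ P (≤-trans h≤q (m≤n+m q p))) ⟩
      W + W * h        ≡⟨ *-suc W h ⟨
      W * suc h        ≤⟨ m≤n+m _ c ⟩
      c + W * suc h    ∎

    upper : c + W * suc h < P * h + W * h + W
    upper = begin-strict
      c + W * suc h      ≡⟨ cong (λ x → c + x) (trans (*-suc W h) (+-comm W (W * h))) ⟩
      c + (W * h + W)    <⟨ +-monoˡ-< (W * h + W) c<P*h ⟩
      P * h + (W * h + W) ≡⟨ +-assoc (P * h) (W * h) W ⟨
      P * h + W * h + W  ∎

  -- Weak monotonicity gives `P * h ≤ c`, which excludes `t′ = h`; the bound `c < W` admits
  -- everything below.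
  ≥half⇒<⇔ : α * p + β < p * P → α * p + β ≥ (p * P ∸ 1) / 2 →
    q * (α + P * t′) + β + p * P * t′ < p * P * q ⇔ t′ < h
  ≥half⇒<⇔ l<N l≥ = linear<⇔ t′ (+-monoˡ-≤ (W * h) P*h≤c) upper ⇔-∘ regroup⇔
    where
    open ≤-Reasoning

    P*h≤c : P * h ≤ c
    P*h≤c = subst (_≤ c) (sym P*h≡)
      (quotient-removal-mono {q} {h * R} {α′ = α} h≤q β≤q (subst (_≤ α * p + β) half≡ l≥))

    c<W : c < W
    c<W = begin-strict
      q * α + β  ≡⟨ cong (_+ β) (*-comm q α) ⟩
      α * q + β  ≤⟨ +-monoˡ-≤ β (*-monoʳ-≤ α (n≤1+n q)) ⟩
      α * p + β  <⟨ l<N ⟩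
      p * P      ≡⟨ *-comm p P ⟩
      P * p      ≤⟨ *-monoʳ-≤ P (m≤m+n p q) ⟩
      W          ∎

    upper : c + W * h < P * h + W * h + W
    upper = begin-strict
      c + W * h            <⟨ +-monoˡ-< (W * h) c<W ⟩
      W + W * h            ≤⟨ m≤n+m _ (P * h) ⟩
      P * h + (W + W * h)  ≡⟨ cong (λ x → P * h + x) (+-comm W (W * h)) ⟩
      P * h + (W * h + W)  ≡⟨ +-assoc (P * h) (W * h) W ⟨
      P * h + W * h + W    ∎

-- The threshold at 2s, with N = p ^ k = 1 + q S

module _ {q N S β′ : ℕ} (t′ : ℕ) (N≡ : N ≡ suc (q * S)) (β′≤q : β′ ≤ q) where
  private
    N*t≡ : ∀ t → N * t ≡ q * (t * S) + t
    N*t≡ t = trans (cong (_* t) N≡) (step q S t)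
      where
      step : ∀ q S t → suc (q * S) * t ≡ q * (t * S) + t
      step = solve-∀

  -- As `l` lies strictly between consecutive indices, `q * l + β′` stays between `N * u` and
  -- `N * suc u` for every `β′ ≤ q`; hence the threshold does not depend on `β′`.
  between⇒⇔ : ∀ {l u} → u < q → u * S < l → l < suc u * S →
    N * q < N * t′ + (q * l + β′) ⇔ suc q ∸ suc u ≤ t′
  between⇒⇔ {l} {u} u<q lo hi =
    <linear⇔ t′ (m+[n∸m]≡n (s≤s (<⇒≤ u<q))) upper lower
    where
    open ≤-Reasoning

    upper : q * l + β′ ≤ N * suc u
    upper = begin
      q * l + β′                  ≤⟨ +-monoʳ-≤ (q * l) β′≤q ⟩
      q * l + q                   ≡⟨ +-comm (q * l) q ⟩
      q + q * l                   ≡⟨ *-suc q l ⟨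
      q * suc l                   ≤⟨ *-monoʳ-≤ q hi ⟩
      q * (suc u * S)             ≤⟨ m≤m+n _ (suc u) ⟩
      q * (suc u * S) + suc u     ≡⟨ N*t≡ (suc u) ⟨
      N * suc u                   ∎

    lower : N * suc u < q * l + β′ + N
    lower = begin-strict
      N * suc u              ≡⟨ *-suc N u ⟩
      N + N * u              ≡⟨ cong (λ x → N + x) (N*t≡ u) ⟩
      N + (q * (u * S) + u)  <⟨ +-monoʳ-< N (+-monoʳ-< (q * (u * S)) u<q) ⟩
      N + (q * (u * S) + q)  ≡⟨ cong (λ x → N + x) (+-comm (q * (u * S)) q) ⟩
      N + (q + q * (u * S))  ≡⟨ cong (λ x → N + x) (*-suc q (u * S)) ⟨
      N + q * suc (u * S)    ≤⟨ +-monoʳ-≤ N (*-monoʳ-≤ q lo) ⟩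
      N + q * l              ≡⟨ +-comm N (q * l) ⟩
      q * l + N              ≤⟨ +-monoˡ-≤ N (m≤m+n (q * l) β′) ⟩
      q * l + β′ + N         ∎

  module _ (q<N : q < N) {t : ℕ} (t≤q : t ≤ q) where
    open ≤-Reasoning

    -- At an index, `q * l` falls short of `N * t` by exactly `t`. Adding `β′ ≤ t` does not pass
    -- `N * t`, so the rounded-up quotient is `t`.
    at-index-≤⇒⇔ : β′ ≤ t → N * q < N * t′ + (q * (t * S) + β′) ⇔ suc q ∸ t ≤ t′
    at-index-≤⇒⇔ β′≤t = <linear⇔ t′ (m+[n∸m]≡n (m≤n⇒m≤1+n t≤q)) upper lower
      where
      upper : q * (t * S) + β′ ≤ N * t
      upper = begin
        q * (t * S) + β′  ≤⟨ +-monoʳ-≤ (q * (t * S)) β′≤t ⟩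
        q * (t * S) + t   ≡⟨ N*t≡ t ⟨
        N * t             ∎

      lower : N * t < q * (t * S) + β′ + N
      lower = begin-strict
        N * t                 ≡⟨ N*t≡ t ⟩
        q * (t * S) + t       <⟨ +-mono-≤-< (m≤m+n _ β′) (≤-<-trans t≤q q<N) ⟩
        q * (t * S) + β′ + N  ∎

    -- Now `β′` exceeds the shortfall `t`, so the rounded-up quotient becomes `suc t` and the
    -- threshold drops by one.
    at-index->⇒⇔ : β′ > t → N * q < N * t′ + (q * (t * S) + β′) ⇔ suc q ∸ t ∸ 1 ≤ t′
    at-index->⇒⇔ β′>t = <linear⇔ t′ sum≡ upper lower
      where
      sum≡ : suc t + (suc q ∸ t ∸ 1) ≡ suc q
      sum≡ = begin-equality
        suc t + (suc q ∸ t ∸ 1)    ≡⟨ cong (λ x → suc t + x) (∸-+-assoc (suc q) t 1) ⟩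
        suc t + (suc q ∸ (t + 1))  ≡⟨ cong (λ x → suc t + (suc q ∸ x)) (+-comm t 1) ⟩
        suc t + (q ∸ t)            ≡⟨ m+[n∸m]≡n (s≤s t≤q) ⟩
        suc q                      ∎

      upper : q * (t * S) + β′ ≤ N * suc t
      upper = begin
        q * (t * S) + β′       ≤⟨ +-mono-≤ (m≤m+n _ t) (≤-trans β′≤q (<⇒≤ q<N)) ⟩
        q * (t * S) + t + N    ≡⟨ cong (_+ N) (N*t≡ t) ⟨
        N * t + N              ≡⟨ +-comm (N * t) N ⟩
        N + N * t              ≡⟨ *-suc N t ⟨
        N * suc t              ∎

      lower : N * suc t < q * (t * S) + β′ + N
      lower = begin-strict
        N * suc t              ≡⟨ *-suc N t ⟩
        N + N * t              ≡⟨ +-comm N (N * t) ⟩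
        N * t + N              ≡⟨ cong (_+ N) (N*t≡ t) ⟩
        q * (t * S) + t + N    <⟨ +-monoˡ-< N (+-monoʳ-< (q * (t * S)) β′>t) ⟩
        q * (t * S) + β′ + N   ∎

-- The four cases for an odd prime `p = 1 + 2h`

mainTheorem3 : (p k s l α β t′ β′ : ℕ) (m n : ℕ → ℤ) →
  Prime p → 2 ∤ p → k ≥ 1 → s ≥ 2 →
  l < p ^ k → l ≡ α * p + β → α < p ^ (k ∸ 1) → β ≤ p ∸ 1 →
  t′ ≤ p ∸ 1 → β′ ≤ p ∸ 1 →
  LastThreeBlocks p k s l α β t′ β′ m n →
  (l < (p ^ k ∸ 1) / 2 →
    DescentAt m n (2 * s ∸ 1) ⇔ (t′ ≤ (p ∸ 1) / 2))
  × (l ≥ (p ^ k ∸ 1) / 2 →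
    DescentAt m n (2 * s ∸ 1) ⇔ (t′ < (p ∸ 1) / 2))
  × ((t : ℕ) → 1 ≤ t → t ≤ p ∸ 1 → jIndex p k (t ∸ 1) < l → l < jIndex p k t →
    DescentAt m n (2 * s) ⇔ (p ∸ t ≤ t′ × t′ ≤ p ∸ 1))
  × ((t : ℕ) → t ≤ p ∸ 1 → l ≡ jIndex p k t →
    (β′ ≤ t → DescentAt m n (2 * s) ⇔ (p ∸ t ≤ t′ × t′ ≤ p ∸ 1))
    × (β′ > t → DescentAt m n (2 * s) ⇔ (p ∸ t ∸ 1 ≤ t′ × t′ ≤ p ∸ 1)))
mainTheorem3 p (suc k) s l α β t′ β′ m n pPrime 2∤p _ s≥2 l<N refl _ β≤q t′≤q β′≤q blocks
  with odd⇒1+2h p 2∤p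
-- `h = 0` would give `p = 1`; otherwise `h > 0`, as the strict comparison in case (1) requires.
... | zero      , refl = ⊥-elim (¬prime[1] pPrime)
... | h@(suc _) , refl =
    (λ l< → subst (λ x → DescentAt m n (2 * s ∸ 1) ⇔ (t′ ≤ x)) half-q
              (<half⇒≤⇔ {R = R} {α} t′ P≡ β≤q (s≤s z≤n) l< ⇔-∘ descentAt[2s-1]⇔ blocks s≥2))
  , (λ l≥ → subst (λ x → DescentAt m n (2 * s ∸ 1) ⇔ (t′ < x)) half-q
              (≥half⇒<⇔ {R = R} {α} t′ P≡ β≤q l<N l≥ ⇔-∘ descentAt[2s-1]⇔ blocks s≥2))
  , (λ { (suc u) _ u<q lo hi →
           bounded (between⇒⇔ t′ N≡ β′≤q u<q (subst (_< l) (j≡ u) lo) (subst (l <_) (j≡ (suc u)) hi)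
                    ⇔-∘ descentAt[2s]⇔ blocks) })
  , (λ t t≤q l≡ → let l≡tS = trans l≡ (j≡ t) in
       (λ β′≤t → bounded (at-index-≤⇒⇔ t′ N≡ β′≤q q<N t≤q β′≤t ⇔-∘ descent-at l≡tS))
     , (λ β′>t → bounded (at-index->⇒⇔ t′ N≡ β′≤q q<N t≤q β′>t ⇔-∘ descent-at l≡tS)))
  where
  q = h * 2
  N = suc q ^ suc k
  -- After the match `k` is one less than the exponent of `N`, so `R` is the geometric sum belonging
  -- to `P`.
  R = jIndex (suc q) k 1
  P≡ = ^≡1+pred*geometric q k
  N≡ = ^≡1+pred*geometric q (suc k)
  j≡ = jIndex≡*jIndex-1 (suc q) (suc k)

  half-q : h ≡ q / 2
  half-q = sym (m*n/n≡m h 2)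

  q<N : q < N
  q<N = subst (λ x → suc q ≤ suc q * x) (sym P≡) (m≤m*n (suc q) _)

  descent-at : ∀ {x} → l ≡ x → DescentAt m n (2 * s) ⇔ N * q < N * t′ + (q * x + β′)
  descent-at refl = descentAt[2s]⇔ blocks

  bounded : ∀ {D : Set} {f} → D ⇔ (f ≤ t′) → D ⇔ (f ≤ t′ × t′ ≤ q)
  bounded D⇔ = mk⇔ (_, t′≤q) proj₁ ⇔-∘ D⇔
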